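{- Let $f:[n]^3\to\{0,1\}$ be the Exactly-$n$ function: $f(x,y,z)=1$ if and only if $x+y+z=n$. Fix a base $m$ and let $d=1+\lceil\log_m n\rceil$. Then the three-player number-on-the-forehead protocol for $f$ described in the context is correct: on every input $(x,y,z)\in[n]^3$ it outputs $f(x,y,z)$.
   Context: $[n]=\{1,\dots,n\}$. In the number-on-the-forehead (NOF) model, on input $(x,y,z)$ player 1 sees $y,z$, player 2 sees $x,z$, and player 3 sees $x,y$; the players communicate by writing on a blackboard visible to all. Every number is represented in base $m$ by a vector in $\{0,1,\dots,m-1\}^d$, where the first coordinate is the least significant digit and the representation is padded with zeros to length $d$. Write $x_i,y_i,z_i$ for the digits of $x,y,z$, and let $T=(T_1,\dots,T_d)$ be the base-$m$ representation of $n$. The protocol is as follows. (1) Player 1 computes the vector $C_x=C\in\{0,1,2\}^d$ whose $i$-th entry $C_i$ is the $k\in\{0,1,2\}$ satisfying $T_i+(k-1)m<y_i+z_i+C_{i-1}\le T_i+km$, where addition is over $\mathbb{Z}$ and $C_0=0$. (2) Players 2 and 3 compute corresponding vectors $C_y$ and $C_z$ in the same way, from the two inputs each of them sees (player 2 uses $x_i+z_i$ and player 3 uses $x_i+y_i$ in place of $y_i+z_i$). (3) Player 1 writes $C=C_x$ on the blackboard. (4) Players 2 and 3, in turn, write $1$ if their vector ($C_y$, respectively $C_z$) is equal to $C_x$, and $0$ otherwise. (5) If the last two bits written are both equal to $1$, the protocol continues; otherwise it outputs $0$ and terminates. (6) All players compute (in private) the vector $T'$ with $T'_i=T_i+mC_i-C_{i-1}$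 for $i=1,\dots,d$. (7) Regarding $x,y,z$ as their digit vectors in $\mathbb{Z}^d$, the players run a (correct) NOF protocol that decides whether $x+y+z=T'$ in $\mathbb{Z}^d$, and output its answer.
   Formalization: The case of base m = 2 with n a power of 2 is excluded: there, on x = y = z = n, all three vectors agree with last carry 1, so x+y+z = T' in Z^d and the protocol outputs 1 although 3n ≠ n. -}

module Defs where

open import Data.Bool.Base using (Bool; false; if_then_else_; _∧_)
open import Data.Fin.Base as Fin using (Fin; toℕ)
open import Data.Fin.Patterns using (0F; 1F; 2F)
import Data.Fin.Properties as Fin
open import Data.Integer.Base as ℤ using (ℤ; +_)
import Data.Integer.Properties as ℤ
open import Data.Nat.Base
open import Data.Nat.DivMod using (_/_; _mod_)
open import Data.Nat.Properties
open import Data.Product using (∃; ∃!; _×_; _,_; proj₁)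
open import Data.Vec.Base as Vec using (Vec; []; _∷_; head; tail; zipWith)
open import Data.Vec.Properties using (≡-dec)
open import Function.Base using (_∘_)
open import Relation.Nullary using (does; yes; no)
open import Relation.Binary.PropositionalEquality

------------------------------------------------------------------------
-- Number-on-the-forehead protocols

data Player : Set where
  player1 player2 player3 : Player

sees : ∀ {A : Set} → Player → A → A → A → A × A
sees player1 x y z = y , z
sees player2 x y z = x , z
sees player3 x y z = x , y

-- A protocol tree over inputs from A × A × A.  In `write p k msg next` player
-- p writes a symbol of a k-letter alphabet, which depends on the two inputs p
-- sees and on the blackboard so far (the position in the tree); everything
-- else, including the final answer, depends on the blackboard alone.
data Protocol (A : Set) : Set where
  output : Bool → Protocol A
  write  : Player → (k : ℕ) → (A × A → Fin k) → (Fin k → Protocol A) →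
           Protocol A

run : ∀ {A} → Protocol A → A → A → A → Bool
run (output b)           x y z = b
run (write p k msg next) x y z = run (next (msg (sees p x y z))) x y z

Computes : ∀ {A} → Protocol A → (A → A → A → Bool) → Set
Computes P f = ∀ x y z → run P x y z ≡ f x y z

writeVec : ∀ {A} (d : ℕ) → Player → (k : ℕ) → (A × A → Vec (Fin k) d) →
           (Vec (Fin k) d → Protocol A) → Protocol A
writeVec zero    p k msg next = next []
writeVec (suc d) p k msg next =
  write p k (head ∘ msg) λ c →
  writeVec d p k (tail ∘ msg) λ cs → next (c ∷ cs)

-- Each player translates the inputs it sees by f, then P is run.
comap : ∀ {A B : Set} → (A → B) → Protocol B → Protocol A
comap f (output b)           = output b
comap f (write p k msg next) =
  write p k (λ (u , v) → msg (f u , f v)) λ s → comap f (next s)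

------------------------------------------------------------------------
-- Inputs from [n] = {1, …, n}, and the function Exactly-n

val : ∀ {n} → Fin n → ℕ
val i = suc (toℕ i)

exactly : (n : ℕ) → Fin n → Fin n → Fin n → Bool
exactly n x y z = does (val x + val y + val z ≟ n)

------------------------------------------------------------------------
-- ⌈ log_m n ⌉

-- For n ≥ 1 the logarithm is nonnegative, so its ceiling is the least
-- natural number k with log_m n ≤ k.  (n = 0 is irrelevant: [0] is empty.)
IsCeilLog : ℕ → ℕ → ℕ → Set
IsCeilLog m n k = n ≤ m ^ k × (∀ j → n ≤ m ^ j → k ≤ j)

n≤m^n : ∀ m n → 2 ≤ m → n ≤ m ^ n
n≤m^n m zero    2≤m = z≤n
n≤m^n m (suc n) 2≤m = begin
  suc n              ≤⟨ +-mono-≤ 1≤m^n (n≤m^n m n 2≤m) ⟩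
  m ^ n + m ^ n      ≡⟨ cong (λ w → m ^ n + w) (sym (+-identityʳ (m ^ n))) ⟩
  2 * m ^ n          ≤⟨ *-monoˡ-≤ (m ^ n) 2≤m ⟩
  m * m ^ n          ∎
  where
  open ≤-Reasoning
  1≤m^n : 1 ≤ m ^ n
  1≤m^n = m^n>0 m {{>-nonZero (≤-trans (s≤s z≤n) 2≤m)}} n

ceilLog : ∀ m n .{{_ : NonTrivial m}} → ∃ (IsCeilLog m n)
ceilLog m n = search n 0 (λ _ _ → z≤n)
                (subst (λ e → n ≤ m ^ e) (sym (+-identityʳ n))
                  (n≤m^n m n (nonTrivial⇒n>1 m)))
  where
  search : ∀ fuel k → (∀ j → n ≤ m ^ j → k ≤ j) → n ≤ m ^ (fuel + k) →
           ∃ (IsCeilLog m n)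
  search zero       k least bound = k , bound , least
  search (suc fuel) k least bound with n ≤? m ^ k
  ... | yes n≤m^k = k , n≤m^k , least
  ... | no  n≰m^k = search fuel (suc k)
    (λ j n≤m^j → ≤∧≢⇒< (least j n≤m^j) λ { refl → n≰m^k n≤m^j })
    (subst (λ e → n ≤ m ^ e) (sym (+-suc fuel k)) bound)

⌈log[_]_⌉ : ∀ m n .{{_ : NonTrivial m}} → ℕ
⌈log[ m ] n ⌉ = proj₁ (ceilLog m n)

------------------------------------------------------------------------
-- Base-m digits, least significant first, padded to length d

-- Digits beyond the d-th would be dropped, so this represents x if x < m ^ d.
digits : ∀ m .{{_ : NonTrivial m}} (d : ℕ) → ℕ → Vec (Fin m) d
digits m zero    x = []
digits m (suc d) x =
  _mod_ x m {{nonTrivial⇒nonZero m}} ∷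
  digits m d (_/_ x m {{nonTrivial⇒nonZero m}})

toℤ : ∀ {m} → Fin m → ℤ
toℤ i = + toℕ i

toℤᵈ : ∀ {m d} → Vec (Fin m) d → Vec ℤ d
toℤᵈ = Vec.map toℤ

_⊕_ : ∀ {d} → Vec ℤ d → Vec ℤ d → Vec ℤ d
_⊕_ = zipWith ℤ._+_

sumsTo : ∀ {m d} → Vec ℤ d →
         Vec (Fin m) d → Vec (Fin m) d → Vec (Fin m) d → Bool
sumsTo T′ x y z = does (≡-dec ℤ._≟_ ((toℤᵈ x ⊕ toℤᵈ y) ⊕ toℤᵈ z) T′)

------------------------------------------------------------------------
-- The vectors C and T′

-- t + (k - 1) m < a + b + c ≤ t + k m
IsCarry : ∀ {m} → Fin m → Fin m → Fin m → Fin 3 → Fin 3 → Set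
IsCarry {m} t a b c k =
  toℤ t ℤ.+ (toℤ k ℤ.- + 1) ℤ.* + m ℤ.< toℤ a ℤ.+ toℤ b ℤ.+ toℤ c ×
  toℤ a ℤ.+ toℤ b ℤ.+ toℤ c ℤ.≤ toℤ t ℤ.+ toℤ k ℤ.* + m

module _ {m : ℕ} (t a b : Fin m) (c : Fin 3) where

  private
    s : ℕ
    s = toℕ a + toℕ b + toℕ c

    shift : ∀ k → toℤ t ℤ.+ (+ k ℤ.- + 1) ℤ.* + m ℤ.+ + m ≡ + (toℕ t + k * m)
    shift k = begin
      toℤ t ℤ.+ (+ k ℤ.- + 1) ℤ.* + m ℤ.+ + m
        ≡⟨ ℤ.+-assoc (toℤ t) ((+ k ℤ.- + 1) ℤ.* + m) (+ m) ⟩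
      toℤ t ℤ.+ ((+ k ℤ.- + 1) ℤ.* + m ℤ.+ + m)
        ≡⟨ cong (λ w → toℤ t ℤ.+ ((+ k ℤ.- + 1) ℤ.* + m ℤ.+ w))
             (sym (ℤ.*-identityˡ (+ m))) ⟩
      toℤ t ℤ.+ ((+ k ℤ.- + 1) ℤ.* + m ℤ.+ + 1 ℤ.* + m)
        ≡⟨ cong (λ w → toℤ t ℤ.+ w)
             (sym (ℤ.*-distribʳ-+ (+ m) (+ k ℤ.- + 1) (+ 1))) ⟩
      toℤ t ℤ.+ (+ k ℤ.- + 1 ℤ.+ + 1) ℤ.* + m
        ≡⟨ cong (λ w → toℤ t ℤ.+ w ℤ.* + m)
             (trans (ℤ.+-assoc (+ k) (ℤ.- + 1) (+ 1)) (ℤ.+-identityʳ (+ k))) ⟩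
      toℤ t ℤ.+ + k ℤ.* + m
        ≡⟨ cong (λ w → toℤ t ℤ.+ w) (sym (ℤ.pos-* k m)) ⟩
      + (toℕ t + k * m) ∎
      where open ≡-Reasoning

    fromℕ : ∀ k → toℕ t + toℕ k * m < s + m → s ≤ toℕ t + toℕ k * m →
            IsCarry t a b c k
    fromℕ k lo hi =
      ℤ.≰⇒> (λ s≤ → ℤ.<⇒≱ (ℤ.+<+ lo)
        (subst (+ (s + m) ℤ.≤_) (shift (toℕ k)) (ℤ.+-monoˡ-≤ (+ m) s≤))) ,
      subst (λ w → + s ℤ.≤ toℤ t ℤ.+ w) (ℤ.pos-* (toℕ k) m) (ℤ.+≤+ hi)

    toℕ-lo : ∀ k → IsCarry t a b c k → toℕ t + toℕ k * m < s + m
    toℕ-lo k (lo , _) = ℤ.drop‿+<+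
      (subst (ℤ._< + (s + m)) (shift (toℕ k)) (ℤ.+-monoˡ-< (+ m) lo))

    toℕ-hi : ∀ k → IsCarry t a b c k → s ≤ toℕ t + toℕ k * m
    toℕ-hi k (_ , hi) = ℤ.drop‿+≤+
      (subst (λ w → + s ℤ.≤ toℤ t ℤ.+ w) (sym (ℤ.pos-* (toℕ k) m)) hi)

    ≤-of : ∀ k l → IsCarry t a b c k → IsCarry t a b c l → toℕ k ≤ toℕ l
    ≤-of k l ck cl = ≮⇒≥ λ l<k → <-irrefl refl (begin-strict
      toℕ t + toℕ k * m        <⟨ toℕ-lo k ck ⟩
      s + m                    ≤⟨ +-monoˡ-≤ m (toℕ-hi l cl) ⟩
      toℕ t + toℕ l * m + m    ≡⟨ +-assoc (toℕ t) (toℕ l * m) m ⟩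
      toℕ t + (toℕ l * m + m)  ≡⟨ cong (λ w → toℕ t + w) (+-comm (toℕ l * m) m) ⟩
      toℕ t + suc (toℕ l) * m  ≤⟨ +-monoʳ-≤ (toℕ t) (*-monoˡ-≤ m l<k) ⟩
      toℕ t + toℕ k * m        ∎)
      where open ≤-Reasoning

    unique : ∀ {k l} → IsCarry t a b c k → IsCarry t a b c l → k ≡ l
    unique {k} {l} ck cl =
      Fin.toℕ-injective (≤-antisym (≤-of k l ck cl) (≤-of l k cl ck))

    step : ∀ j → toℕ t + j * m < s → toℕ t + suc j * m < s + m
    step j lt = begin-strict
      toℕ t + (m + j * m)  ≡⟨ cong (λ w → toℕ t + w) (+-comm m (j * m)) ⟩
      toℕ t + (j * m + m)  ≡⟨ sym (+-assoc (toℕ t) (j * m) m) ⟩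
      toℕ t + j * m + m    <⟨ +-monoˡ-< m lt ⟩
      s + m                ∎
      where open ≤-Reasoning

    s≤2m : s ≤ 2 * m
    s≤2m = begin
      toℕ a + toℕ b + toℕ c
        ≤⟨ +-monoʳ-≤ (toℕ a + toℕ b) (s≤s⁻¹ (Fin.toℕ<n c)) ⟩
      toℕ a + toℕ b + 2          ≡⟨ +-comm (toℕ a + toℕ b) 2 ⟩
      suc (suc (toℕ a + toℕ b))  ≡⟨ cong suc (sym (+-suc (toℕ a) (toℕ b))) ⟩
      suc (toℕ a) + suc (toℕ b)  ≤⟨ +-mono-≤ (Fin.toℕ<n a) (Fin.toℕ<n b) ⟩
      m + m                      ≡⟨ cong (λ w → m + w) (sym (+-identityʳ m)) ⟩
      2 * m                      ∎
      where open ≤-Reasoning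

  theCarry : ∃! _≡_ (IsCarry t a b c)
  theCarry with s ≤? toℕ t + 0 * m | s ≤? toℕ t + 1 * m
  ... | yes hi | _      = 0F , is , unique is
    where
    is : IsCarry t a b c 0F
    is = fromℕ 0F (begin-strict
           toℕ t + 0  ≡⟨ +-identityʳ (toℕ t) ⟩
           toℕ t      <⟨ Fin.toℕ<n t ⟩
           m          ≤⟨ m≤n+m m s ⟩
           s + m      ∎) hi
      where open ≤-Reasoning
  ... | no  lo | yes hi = 1F , is , unique is
    where
    is : IsCarry t a b c 1F
    is = fromℕ 1F (step 0 (≰⇒> lo)) hi
  ... | no  _  | no  lo = 2F , is , unique is
    where
    is : IsCarry t a b c 2F
    is = fromℕ 2F (step 1 (≰⇒> lo)) (≤-trans s≤2m (m≤n+m (2 * m) (toℕ t)))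

  carry : Fin 3
  carry = proj₁ theCarry

-- The first argument is the entry preceding the vector being computed.
carriesFrom : ∀ {m d} → Fin 3 → Vec (Fin m) d → Vec (Fin m) d → Vec (Fin m) d →
              Vec (Fin 3) d
carriesFrom c []      []      []      = []
carriesFrom c (t ∷ T) (a ∷ u) (b ∷ v) =
  carry t a b c ∷ carriesFrom (carry t a b c) T u v

carries : ∀ {m d} → Vec (Fin m) d → Vec (Fin m) d × Vec (Fin m) d →
          Vec (Fin 3) d
carries T (u , v) = carriesFrom 0F T u v

targetFrom : ∀ {m d} → Fin 3 → Vec (Fin m) d → Vec (Fin 3) d → Vec ℤ d
targetFrom         c₀ []      []      = []
targetFrom {m = m} c₀ (t ∷ T) (c ∷ C) =
  (toℤ t ℤ.+ + m ℤ.* toℤ c ℤ.- toℤ c₀) ∷ targetFrom c T C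

target : ∀ {m d} → Vec (Fin m) d → Vec (Fin 3) d → Vec ℤ d
target = targetFrom 0F

------------------------------------------------------------------------
-- The protocol

-- Q T′ is the protocol used to decide x + y + z = T′ in ℤ^d.
exactlyProtocol : ∀ m n d .{{_ : NonTrivial m}} →
                  (Vec ℤ d → Protocol (Vec (Fin m) d)) → Protocol (Fin n)
exactlyProtocol m n d Q =
  writeVec d player1 3 C-of λ C →
  write player2 2 (agrees C) λ b₂ →
  write player3 2 (agrees C) λ b₃ →
  if does (b₂ Fin.≟ 1F) ∧ does (b₃ Fin.≟ 1F)
    then comap rep (Q (target T C))
    else output false
  where
  rep : Fin n → Vec (Fin m) d
  rep x = digits m d (val x)

  T : Vec (Fin m) d
  T = digits m d n

  C-of : Fin n × Fin n → Vec (Fin 3) d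
  C-of (u , v) = carries T (rep u , rep v)

  agrees : Vec (Fin 3) d → Fin n × Fin n → Fin 2
  agrees C uv = if does (≡-dec Fin._≟_ (C-of uv) C) then 1F else 0F

-- The case to be excluded: for m = 2 and n = 2 ^ k we have d = 1 + k, and on
-- x = y = z = n all three carry vectors are (0, …, 0, 1), so that
-- T′ = (0, …, 0, 3) = x + y + z in ℤ^d and the protocol outputs 1, although
-- 3 n ≠ n.
Exceptional : ℕ → ℕ → Set
Exceptional m n = m ≡ 2 × ∃ λ k → n ≡ 2 ^ k

{-# OPTIONS --safe #-}
-- If x + y + z = n, then adding the digit vectors column by column produces
-- carries c ∈ {0,1,2}^d with x_i + y_i + z_i + c_{i-1} = T_i + m c_i, and the
-- inequalities defining C_x, C_y and C_z each characterise this c.  So the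
-- three vectors agree and x + y + z = T′.
--
-- Conversely x + y + z = T′ in ℤ^d telescopes to x + y + z = n + C_d m^d.  If
-- C_d ≥ 1, then m^d ≤ 2n ≤ 2 m^(d-1), which forces m = 2 and n = 2^(d-1),
-- the exceptional case.
module Submission where

open import Defs
open import Data.Bool.Base using (true; false; if_then_else_; _∧_)
open import Data.Integer.Base as ℤ using (ℤ; +_)
import Data.Integer.Properties as ℤ
import Data.Integer.Tactic.RingSolver as ℤ-Solver
open import Data.Fin.Base using (Fin; toℕ; fromℕ<)
open import Data.Fin.Patterns using (0F; 1F)
import Data.Fin.Properties as Fin
open import Data.Nat.Base
open import Data.Nat.DivMod
open import Data.Nat.Properties
open import Data.Nat.Tactic.RingSolver using (solve-∀)
open import Data.Product using (∃; _×_; _,_; proj₁; proj₂)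
open import Data.Vec.Base using (Vec; []; _∷_; head; tail)
open import Data.Vec.Properties using (≡-dec; ∷-injective)
open import Function.Base using (_∘_)
open import Function.Bundles using (mk⇔)
open import Relation.Nullary using (¬_; does; contradiction)
open import Relation.Nullary.Decidable using (_×-dec_; does-⇔)
open import Relation.Binary.PropositionalEquality

-- Evaluation of protocols on a fixed input.

run-writeVec : ∀ {A} d p k (msg : A × A → Vec (Fin k) d) next x y z →
               run (writeVec d p k msg next) x y z ≡
               run (next (msg (sees p x y z))) x y z
run-writeVec zero p k msg next x y z with msg (sees p x y z)
... | [] = refl
run-writeVec (suc d) p k msg next x y z = trans
  (run-writeVec d p k (tail ∘ msg) _ x y z)
  -- The letters written one by one reassemble the message; `Vec` has no eta rule, so this needs a
  -- case split.
  (cong (λ cs → run (next cs) x y z) (head∷tail (msg (sees p x y z))))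
  where
  head∷tail : ∀ (v : Vec (Fin k) (suc d)) → head v ∷ tail v ≡ v
  head∷tail (_ ∷ _) = refl

run-comap : ∀ {A B : Set} (f : A → B) P x y z →
            run (comap f P) x y z ≡ run P (f x) (f y) (f z)
run-comap f (output b)                 x y z = refl
-- `sees` reduces only once the player is known.
run-comap f (write player1 k msg next) x y z = run-comap f (next _) x y z
run-comap f (write player2 k msg next) x y z = run-comap f (next _) x y z
run-comap f (write player3 k msg next) x y z = run-comap f (next _) x y z

run-guarded : ∀ {A} b₂ b₃ (P : Protocol A) x y z →
              run (if does (Fin._≟_ {2} (if b₂ then 1F else 0F) 1F) ∧
                      does (Fin._≟_ {2} (if b₃ then 1F else 0F) 1F)
                   then P else output false) x y z ≡
              b₂ ∧ b₃ ∧ run P x y z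
run-guarded false b₃    P x y z = refl
run-guarded true  false P x y z = refl
run-guarded true  true  P x y z = refl

run-exactlyProtocol :
  ∀ m n d .{{_ : NonTrivial m}} (Q : Vec ℤ d → Protocol (Vec (Fin m) d)) x y z →
  let T = digits m d n
      X = digits m d (val x)
      Y = digits m d (val y)
      Z = digits m d (val z)
      C = carries T (Y , Z)
  in run (exactlyProtocol m n d Q) x y z ≡
     does (≡-dec Fin._≟_ (carries T (X , Z)) C) ∧
     does (≡-dec Fin._≟_ (carries T (X , Y)) C) ∧
     run (Q (target T C)) X Y Z
run-exactlyProtocol m n d Q x y z = begin
  run (exactlyProtocol m n d Q) x y z
    ≡⟨ run-writeVec d player1 3 _ _ x y z ⟩
  _
    ≡⟨ run-guarded b₂ b₃ _ x y z ⟩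
  b₂ ∧ b₃ ∧ run (comap (digits m d ∘ val) (Q (target T C))) x y z
    ≡⟨ cong (λ b → b₂ ∧ b₃ ∧ b)
         (run-comap (digits m d ∘ val) (Q (target T C)) x y z) ⟩
  b₂ ∧ b₃ ∧ run (Q (target T C)) X Y Z ∎
  where
  open ≡-Reasoning
  T = digits m d n
  X = digits m d (val x)
  Y = digits m d (val y)
  Z = digits m d (val z)
  C = carries T (Y , Z)
  b₂ = does (≡-dec Fin._≟_ (carries T (X , Z)) C)
  b₃ = does (≡-dec Fin._≟_ (carries T (X , Y)) C)

-- Values of digit vectors.

value : ∀ {m d} → Vec (Fin m) d → ℕ
value         []      = 0
value {m = m} (a ∷ u) = toℕ a + value u * m

value-digits : ∀ m .{{_ : NonTrivial m}} d x → x < m ^ d →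
               value (digits m d x) ≡ x
value-digits m zero    x x<1 = sym (n<1⇒n≡0 x<1)
value-digits m (suc d) x x<m^d = begin
  toℕ (x mod m) + value (digits m d (x / m)) * m
    ≡⟨ cong₂ (λ r q → r + q * m) (Fin.toℕ-fromℕ< (m%n<n x m))
         (value-digits m d (x / m)
           (m<n*o⇒m/o<n (subst (x <_) (*-comm m (m ^ d)) x<m^d))) ⟩
  x % m + x / m * m
    ≡⟨ m≡m%n+[m/n]*n x m ⟨
  x ∎
  where
  open ≡-Reasoning
  instance
    m≢0 : NonZero m
    m≢0 = nonTrivial⇒nonZero m

-- Column addition, carry vectors and targets.

-- c₀ is the incoming carry; the carry out of the last column is unconstrained.
data Addition {m} : ∀ {d} → Fin 3 → (T X Y Z : Vec (Fin m) d) →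
                    Vec (Fin 3) d → Set where
  []  : ∀ {c₀} → Addition c₀ [] [] [] [] []
  _∷_ : ∀ {d c₀ t x y z c} {T X Y Z : Vec (Fin m) d} {C} →
        toℕ x + toℕ y + toℕ z + toℕ c₀ ≡ toℕ t + toℕ c * m →
        Addition c T X Y Z C →
        Addition c₀ (t ∷ T) (x ∷ X) (y ∷ Y) (z ∷ Z) (c ∷ C)

module _ {m : ℕ} where

  private
    variable
      d : ℕ
      c₀ : Fin 3
      T X Y Z : Vec (Fin m) d
      C : Vec (Fin 3) d

  -- The first summand plays the hidden input, so this permutation gives the view of player 2, and
  -- `rotate` that of player 3.
  swap : Addition c₀ T X Y Z C → Addition c₀ T Y X Z C
  swap [] = []
  swap (_∷_ {c₀ = c₀} {x = x} {y} {z} e es) =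
    trans (cong (λ w → w + toℕ z + toℕ c₀) (+-comm (toℕ y) (toℕ x))) e ∷ swap es

  rotate : Addition c₀ T X Y Z C → Addition c₀ T Z X Y C
  rotate [] = []
  rotate (_∷_ {c₀ = c₀} {x = x} {y} {z} e es) =
    trans (cong (_+ toℕ c₀) (lemma (toℕ x) (toℕ y) (toℕ z))) e ∷ rotate es
    where
    lemma : ∀ x y z → z + x + y ≡ x + y + z
    lemma = solve-∀

  -- The visible sum is `t + c m - x`, and `0 ≤ x < m` places it in the half-open interval that
  -- defines the carry.
  isCarry : ∀ (t x y z : Fin m) (c₀ c : Fin 3) →
            toℕ x + toℕ y + toℕ z + toℕ c₀ ≡ toℕ t + toℕ c * m →
            IsCarry t y z c₀ c
  isCarry t x y z c₀ c e = lo , hi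
    where
    s = toℕ y + toℕ z + toℕ c₀

    x+s : toℕ x + s ≡ toℕ t + toℕ c * m
    x+s = trans (lemma (toℕ x) (toℕ y) (toℕ z) (toℕ c₀)) e
      where
      lemma : ∀ x y z c → x + (y + z + c) ≡ x + y + z + c
      lemma = solve-∀

    top : + (toℕ x + s) ≡ toℤ t ℤ.+ toℤ c ℤ.* + m
    top = trans (cong +_ x+s) (cong (λ w → toℤ t ℤ.+ w) (ℤ.pos-* (toℕ c) m))

    hi : + s ℤ.≤ toℤ t ℤ.+ toℤ c ℤ.* + m
    hi = subst (+ s ℤ.≤_) top (ℤ.+≤+ (m≤n+m s (toℕ x)))

    lower : toℤ t ℤ.+ (toℤ c ℤ.- + 1) ℤ.* + m ℤ.+ + m ≡ + (toℕ x + s)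
    lower = trans (lemma (toℤ t) (toℤ c) (+ m)) (sym top)
      where
      lemma : ∀ t c m → t ℤ.+ (c ℤ.- + 1) ℤ.* m ℤ.+ m ≡ t ℤ.+ c ℤ.* m
      lemma = ℤ-Solver.solve-∀

    lo : toℤ t ℤ.+ (toℤ c ℤ.- + 1) ℤ.* + m ℤ.< + s
    -- Adding `m` to both sides removes the subtraction; what remains is `x + s < s + m`, that is,
    -- `x < m`.
    lo = ℤ.≰⇒> λ s≤ → ℤ.<⇒≱
      (ℤ.+<+ (subst (_< s + m) (+-comm s (toℕ x)) (+-monoʳ-< s (Fin.toℕ<n x))))
      (subst (+ (s + m) ℤ.≤_) lower (ℤ.+-monoˡ-≤ (+ m) s≤))

  -- By `isCarry` and uniqueness, a player who cannot see `X` still recovers the true carries,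
  -- column after column.
  addition⇒carriesFrom : Addition c₀ T X Y Z C → carriesFrom c₀ T Y Z ≡ C
  addition⇒carriesFrom [] = refl
  addition⇒carriesFrom (_∷_ {c₀ = c₀} {t} {x} {y} {z} {c} {T} {X} {Y} {Z} e es) =
    cong₂ _∷_ carry≡c
      (trans (cong (λ k → carriesFrom k T Y Z) carry≡c) (addition⇒carriesFrom es))
    where
    carry≡c : carry t y z c₀ ≡ c
    carry≡c = proj₂ (proj₂ (theCarry t y z c₀)) (isCarry t x y z c₀ c e)

  addition⇒targetFrom : Addition c₀ T X Y Z C →
                        (toℤᵈ X ⊕ toℤᵈ Y) ⊕ toℤᵈ Z ≡ targetFrom c₀ T C
  addition⇒targetFrom [] = refl
  addition⇒targetFrom (_∷_ {c₀ = c₀} {t} {x} {y} {z} {c} e es) =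
    cong₂ _∷_ column (addition⇒targetFrom es)
    where
    open ≡-Reasoning
    cancel : ∀ s c → s ≡ s ℤ.+ c ℤ.- c
    cancel = ℤ-Solver.solve-∀
    column : + (toℕ x + toℕ y + toℕ z) ≡ toℤ t ℤ.+ + m ℤ.* toℤ c ℤ.- toℤ c₀
    column = begin
      + (toℕ x + toℕ y + toℕ z)
        ≡⟨ cancel _ (toℤ c₀) ⟩
      + (toℕ x + toℕ y + toℕ z + toℕ c₀) ℤ.- toℤ c₀
        ≡⟨ cong (λ w → + w ℤ.- toℤ c₀) e ⟩
      toℤ t ℤ.+ + (toℕ c * m) ℤ.- toℤ c₀
        ≡⟨ cong (λ w → toℤ t ℤ.+ w ℤ.- toℤ c₀)
             (trans (cong +_ (*-comm (toℕ c) m)) (ℤ.pos-* m (toℕ c))) ⟩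
      toℤ t ℤ.+ + m ℤ.* toℤ c ℤ.- toℤ c₀ ∎

  -- Moving `c₀` across turns each coordinate of the equation back into a column equation.
  targetFrom⇒addition : ∀ {d} c₀ (T X Y Z : Vec (Fin m) d) C →
                        (toℤᵈ X ⊕ toℤᵈ Y) ⊕ toℤᵈ Z ≡ targetFrom c₀ T C →
                        Addition c₀ T X Y Z C
  targetFrom⇒addition c₀ [] [] [] [] [] eq = []
  targetFrom⇒addition c₀ (t ∷ T) (x ∷ X) (y ∷ Y) (z ∷ Z) (c ∷ C) eq =
    column ∷ targetFrom⇒addition c T X Y Z C (proj₂ (∷-injective eq))
    where
    open ≡-Reasoning
    cancel : ∀ s c → s ℤ.- c ℤ.+ c ≡ s
    cancel = ℤ-Solver.solve-∀
    column : toℕ x + toℕ y + toℕ z + toℕ c₀ ≡ toℕ t + toℕ c * m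
    column = ℤ.+-injective (begin
      + (toℕ x + toℕ y + toℕ z) ℤ.+ toℤ c₀
        ≡⟨ cong (ℤ._+ toℤ c₀) (proj₁ (∷-injective eq)) ⟩
      toℤ t ℤ.+ + m ℤ.* toℤ c ℤ.- toℤ c₀ ℤ.+ toℤ c₀
        ≡⟨ cancel (toℤ t ℤ.+ + m ℤ.* toℤ c) (toℤ c₀) ⟩
      toℤ t ℤ.+ + m ℤ.* toℤ c
        ≡⟨ cong (λ w → toℤ t ℤ.+ w)
             (trans (sym (ℤ.pos-* m (toℕ c))) (cong +_ (*-comm m (toℕ c)))) ⟩
      + (toℕ t + toℕ c * m) ∎)

  -- From columns to values and back.

  value-columns : ∀ x X y Y z Z c₀ →
    x + X * m + (y + Y * m) + (z + Z * m) + c₀ ≡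
    x + y + z + c₀ + (X + Y + Z) * m
  value-columns = lemma m
    where
    lemma : ∀ m x X y Y z Z c₀ →
      x + X * m + (y + Y * m) + (z + Z * m) + c₀ ≡
      x + y + z + c₀ + (X + Y + Z) * m
    lemma = solve-∀

  regroup : ∀ t c S m → t + c * m + S * m ≡ t + (S + c) * m
  regroup = solve-∀

  -- Weighting the columns by powers of `m` makes the inner carries telescope; `k` is the carry out
  -- of the last column.
  addition⇒value : ∀ {d c₀} {T X Y Z : Vec (Fin m) d} {C} →
    Addition c₀ T X Y Z C →
    ∃ λ k → value X + value Y + value Z + toℕ c₀ ≡ value T + k * m ^ d
  addition⇒value {c₀ = c₀} [] = toℕ c₀ , sym (*-identityʳ (toℕ c₀))
  addition⇒value {d = suc d}
    (_∷_ {c₀ = c₀} {t} {x} {y} {z} {c} {T} {X} {Y} {Z} e es)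
    with addition⇒value es
  ... | k , ih = k , (begin
    value (x ∷ X) + value (y ∷ Y) + value (z ∷ Z) + toℕ c₀
      ≡⟨ value-columns (toℕ x) (value X) (toℕ y) (value Y) (toℕ z) (value Z) _ ⟩
    toℕ x + toℕ y + toℕ z + toℕ c₀ + S * m
      ≡⟨ cong (_+ S * m) e ⟩
    toℕ t + toℕ c * m + S * m
      ≡⟨ regroup (toℕ t) (toℕ c) S m ⟩
    toℕ t + (S + toℕ c) * m
      ≡⟨ cong (λ w → toℕ t + w * m) ih ⟩
    toℕ t + (value T + k * m ^ d) * m
      ≡⟨ push (toℕ t) (value T) k (m ^ d) m ⟩
    value (t ∷ T) + k * m ^ suc d ∎)
    where
    open ≡-Reasoning
    S = value X + value Y + value Z
    push : ∀ t T k p m → t + (T + k * p) * m ≡ t + T * m + k * (m * p)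
    push = solve-∀

  -- One step of schoolbook addition: modulo `m` the column sum leaves the digit `t`, and its
  -- quotient by `m` is the carry. `S` and `T` stand for the higher digits.
  column-carry : .{{_ : NonZero m}} → ∀ (t x y z : Fin m) (c₀ : Fin 3) S T →
    toℕ x + toℕ y + toℕ z + toℕ c₀ + S * m ≡ toℕ t + T * m →
    ∃ λ (c : Fin 3) →
      toℕ x + toℕ y + toℕ z + toℕ c₀ ≡ toℕ t + toℕ c * m × S + toℕ c ≡ T
  column-carry t x y z c₀ S T total = c , column , rest
    where
    r = toℕ x + toℕ y + toℕ z + toℕ c₀

    r%m : r % m ≡ toℕ t
    r%m = begin
      r % m                ≡⟨ [m+kn]%n≡m%n r S m ⟨
      (r + S * m) % m      ≡⟨ cong (_% m) total ⟩
      (toℕ t + T * m) % m  ≡⟨ [m+kn]%n≡m%n (toℕ t) T m ⟩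
      toℕ t % m            ≡⟨ m<n⇒m%n≡m (Fin.toℕ<n t) ⟩
      toℕ t                ∎
      where open ≡-Reasoning

    -- Three digits of at most `m - 1` and a carry of at most 2 sum to at most `3 m - 1`, so the new
    -- carry is again at most 2.
    r<3m : r < 3 * m
    r<3m = begin
      suc r
        ≤⟨ s≤s (+-monoʳ-≤ (toℕ x + toℕ y + toℕ z) (s≤s⁻¹ (Fin.toℕ<n c₀))) ⟩
      suc (toℕ x + toℕ y + toℕ z + 2)
        ≡⟨ sucs (toℕ x) (toℕ y) (toℕ z) ⟩
      suc (toℕ x) + (suc (toℕ y) + (suc (toℕ z) + 0))
        ≤⟨ +-mono-≤ (Fin.toℕ<n x) (+-mono-≤ (Fin.toℕ<n y)
             (+-monoˡ-≤ 0 (Fin.toℕ<n z))) ⟩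
      3 * m ∎
      where
      open ≤-Reasoning
      sucs : ∀ x y z →
        suc (x + y + z + 2) ≡ suc x + (suc y + (suc z + 0))
      sucs = solve-∀

    r/m<3 : r / m < 3
    r/m<3 = m<n*o⇒m/o<n r<3m

    c : Fin 3
    c = fromℕ< r/m<3

    column : r ≡ toℕ t + toℕ c * m
    column = trans (m≡m%n+[m/n]*n r m)
      (cong₂ (λ a q → a + q * m) r%m (sym (Fin.toℕ-fromℕ< r/m<3)))

    rest : S + toℕ c ≡ T
    rest = *-cancelʳ-≡ (S + toℕ c) T m (+-cancelˡ-≡ (toℕ t) _ _ (begin
      toℕ t + (S + toℕ c) * m      ≡⟨ regroup (toℕ t) (toℕ c) S m ⟨
      toℕ t + toℕ c * m + S * m    ≡⟨ cong (_+ S * m) column ⟨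
      r + S * m                    ≡⟨ total ⟩
      toℕ t + T * m                ∎))
      where open ≡-Reasoning

  -- Splitting off the lowest column leaves the same equation for the higher digits, with the new
  -- carry coming in.
  value⇒addition : .{{_ : NonZero m}} → ∀ {d} c₀ (T X Y Z : Vec (Fin m) d) →
    value X + value Y + value Z + toℕ c₀ ≡ value T →
    ∃ (Addition c₀ T X Y Z)
  value⇒addition c₀ [] [] [] [] eq = [] , []
  value⇒addition c₀ (t ∷ T) (x ∷ X) (y ∷ Y) (z ∷ Z) eq =
    let c , column , rest =
          column-carry t x y z c₀ (value X + value Y + value Z) (value T)
            (trans (sym (value-columns (toℕ x) (value X) (toℕ y) (value Y)
                                       (toℕ z) (value Z) (toℕ c₀)))
                   eq)
        C , es = value⇒addition c T X Y Z rest
    in c ∷ C , column ∷ es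

-- Excluding a carry out of the last column.

no-overflow : ∀ {m n e s k} → 2 ≤ m → ¬ Exceptional m n →
              n ≤ m ^ e → s ≤ n + n + n → s ≡ n + k * m ^ suc e → s ≡ n
no-overflow {n = n} {k = zero} _ _ _ _ s≡ = trans s≡ (+-identityʳ n)
no-overflow {m} {n} {e} {s} {suc k} 2≤m unexceptional n≤mᵉ s≤3n s≡ =
  contradiction (m≡2 , e , n≡2ᵉ) unexceptional
  where
  open ≤-Reasoning
  p = m ^ e

  instance
    p≢0 : NonZero p
    p≢0 = m^n≢0 m e {{>-nonZero (<-trans z<s 2≤m)}}

  mp≤2n : m * p ≤ 2 * n
  mp≤2n = +-cancelˡ-≤ n (m * p) (2 * n) (begin
    n + m * p              ≤⟨ +-monoʳ-≤ n (m≤m+n (m * p) (k * (m * p))) ⟩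
    n + suc k * (m * p)    ≡⟨ s≡ ⟨
    s                      ≤⟨ s≤3n ⟩
    n + n + n              ≡⟨ lemma n ⟩
    n + 2 * n              ∎)
    where
    lemma : ∀ n → n + n + n ≡ n + 2 * n
    lemma = solve-∀

  m≡2 : m ≡ 2
  m≡2 = ≤-antisym
    -- Cancel `p` in `m p ≤ 2 n ≤ 2 p`.
    (*-cancelʳ-≤ m 2 p (≤-trans mp≤2n (*-monoʳ-≤ 2 n≤mᵉ))) 2≤m

  n≡2ᵉ : n ≡ 2 ^ e
  n≡2ᵉ = subst (λ b → n ≡ b ^ e) m≡2 (≤-antisym n≤mᵉ
    -- Cancel 2 in `2 p ≤ m p ≤ 2 n`.
    (*-cancelˡ-≤ 2 (≤-trans (*-monoˡ-≤ p 2≤m) mp≤2n)))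

-- Correctness of the protocol.

lemma22 : ∀ (m n : ℕ) .{{_ : NonTrivial m}} → ¬ Exceptional m n →
    let d = 1 + ⌈log[ m ] n ⌉ in
    (Q : Vec ℤ d → Protocol (Vec (Fin m) d)) →
    (∀ T′ → Computes (Q T′) (sumsTo T′)) →
    Computes (exactlyProtocol m n d Q) (exactly n)
lemma22 m n unexceptional Q Q-correct x y z = begin
  run (exactlyProtocol m n d Q) x y z
    ≡⟨ run-exactlyProtocol m n d Q x y z ⟩
  does C-y? ∧ does C-z? ∧ run (Q (target T C)) X Y Z
    ≡⟨ cong (λ b → does C-y? ∧ does C-z? ∧ b) (Q-correct (target T C) X Y Z) ⟩
  -- Merging the three tests into one decision reduces the claim to a logical equivalence.
  does (C-y? ×-dec C-z? ×-dec sum?)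
    ≡⟨ does-⇔ (mk⇔ sound complete) (C-y? ×-dec C-z? ×-dec sum?) (s ≟ n) ⟩
  exactly n x y z ∎
  where
  open ≡-Reasoning
  e = ⌈log[ m ] n ⌉
  d = suc e
  s = val x + val y + val z
  T = digits m d n
  X = digits m d (val x)
  Y = digits m d (val y)
  Z = digits m d (val z)
  C = carries T (Y , Z)
  C-y? = ≡-dec Fin._≟_ (carries T (X , Z)) C
  C-z? = ≡-dec Fin._≟_ (carries T (X , Y)) C
  sum? = ≡-dec ℤ._≟_ ((toℤᵈ X ⊕ toℤᵈ Y) ⊕ toℤᵈ Z) (target T C)

  2≤m : 2 ≤ m
  2≤m = nonTrivial⇒n>1 m

  instance
    m≢0 : NonZero m
    m≢0 = nonTrivial⇒nonZero m

  n≤mᵉ : n ≤ m ^ e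
  n≤mᵉ = proj₁ (proj₂ (ceilLog m n))

  -- `n` may equal `m ^ e`, which has `e + 1` digits; the extra digit in `d` makes room for it.
  value-rep : ∀ {a} → a ≤ n → value (digits m d a) ≡ a
  value-rep a≤n = value-digits m d _
    (≤-<-trans (≤-trans a≤n n≤mᵉ) (^-monoʳ-< m 2≤m (n<1+n e)))

  -- The summand 0 is the initial carry.
  value-sum : value X + value Y + value Z + 0 ≡ s
  value-sum = trans (+-identityʳ _)
    (cong₂ _+_ (cong₂ _+_ (value-rep (Fin.toℕ<n x)) (value-rep (Fin.toℕ<n y)))
               (value-rep (Fin.toℕ<n z)))

  s≤3n : s ≤ n + n + n
  s≤3n = +-mono-≤ (+-mono-≤ (Fin.toℕ<n x) (Fin.toℕ<n y)) (Fin.toℕ<n z)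

  Accepted : Set
  Accepted = carries T (X , Z) ≡ C × carries T (X , Y) ≡ C ×
             (toℤᵈ X ⊕ toℤᵈ Y) ⊕ toℤᵈ Z ≡ target T C

  sound : Accepted → s ≡ n
  sound (_ , _ , X+Y+Z≡T′) =
    let k , eq = addition⇒value (targetFrom⇒addition 0F T X Y Z C X+Y+Z≡T′)
    in no-overflow {e = e} {k = k} 2≤m unexceptional n≤mᵉ s≤3n
         (trans (sym value-sum)
           (trans eq (cong (_+ k * m ^ d) (value-rep ≤-refl))))

  complete : s ≡ n → Accepted
  complete s≡n =
    -- All three players' vectors are compared with the carries of this one addition.
    let _ , adds = value⇒addition 0F T X Y Z
          (trans value-sum (trans s≡n (sym (value-rep ≤-refl))))
        C≡C′ = addition⇒carriesFrom adds
    in trans (addition⇒carriesFrom (swap adds)) (sym C≡C′) ,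
       trans (addition⇒carriesFrom (rotate adds)) (sym C≡C′) ,
       trans (addition⇒targetFrom adds) (cong (target T) (sym C≡C′))
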